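{- Let $G$ and $H$ be connected graphs, each on $n$ vertices, with minimum degrees $\delta(G)$ and $\delta(H)$, and let $\delta=\min\{\delta(G),\delta(H)\}$. If $\delta\geq 2^{12n/\delta+15}$, then $G\Box H$ is of Class 0, i.e. $\pi(G\Box H)$ equals the number of vertices of $G\Box H$.
   Context: Pebbling: a pebbling configuration on a graph $G$ is a distribution of pebbles to the vertices of $G$. A pebbling step removes two pebbles from a vertex $v$ that has at least two pebbles and places one pebble on a neighbor of $v$. A configuration is $r$-solvable if some sequence of pebbling steps places a pebble on the vertex $r$, and solvable if it is $r$-solvable for every vertex $r$. The pebbling number $\pi(G)$ is the least integer such that every configuration of that many pebbles on $G$ is solvable. A graph $G$ is of Class 0 if $\pi(G)=|V(G)|$. The Cartesian product $G\Box H$ has vertex set $V(G)\times V(H)$, with $(g,h)$ adjacent to $(g',h')$ iff either $g=g'$ and $hh'\in E(H)$, or $h=h'$ and $gg'\in E(G)$. -}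

module Defs where

open import Data.Nat using (ℕ; zero; suc; _+_; _*_; _∸_; _^_; _≤_; _<_; _⊓_)
open import Data.Fin using (Fin; remQuot)
import Data.Fin as Fin
open import Data.Bool using (Bool; true; false; if_then_else_)
open import Data.Product using (Σ; ∃; _×_; _,_; proj₁; proj₂)
open import Data.Sum using (_⊎_; inj₁; inj₂)
open import Data.Empty using (⊥)
open import Relation.Nullary using (¬_; Dec; yes; no)
open import Relation.Nullary.Decidable using (⌊_⌋; _×-dec_; _⊎-dec_)
open import Relation.Binary.PropositionalEquality using (_≡_; refl)
open import Relation.Binary.Construct.Closure.ReflexiveTransitive using (Star)

record Graph (n : ℕ) : Set₁ where
  field
    Adj    : Fin n → Fin n → Set
    adj?   : (u v : Fin n) → Dec (Adj u v)
    adj-sym : ∀ {u v} → Adj u v → Adj v u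
    irrefl : ∀ {u} → ¬ Adj u u
open Graph public

total : (n : ℕ) → (Fin n → ℕ) → ℕ
total zero    f = 0
total (suc n) f = f Fin.zero + total n (λ i → f (Fin.suc i))

minOver : (n : ℕ) → (Fin n → ℕ) → ℕ
minOver zero          f = 0
minOver (suc zero)    f = f Fin.zero
minOver (suc (suc n)) f = f Fin.zero ⊓ minOver (suc n) (λ i → f (Fin.suc i))

degree : ∀ {n} → Graph n → Fin n → ℕ
degree {n} G v = total n (λ w → if ⌊ adj? G v w ⌋ then 1 else 0)

minDegree : ∀ {n} → Graph n → ℕ
minDegree {n} G = minOver n (degree G)

Connected : ∀ {n} → Graph n → Set
Connected G = ∀ u v → Star (Adj G) u v

-- Cartesian product G □ H, with vertex (g , h) encoded as combine g h : Fin (n * m)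
-- (decoded by remQuot).
ProdAdj : ∀ {n m} → Graph n → Graph m → Fin (n * m) → Fin (n * m) → Set
ProdAdj {n} {m} G H x y =
  let g  = proj₁ (remQuot {n} m x) ; h  = proj₂ (remQuot {n} m x)
      g' = proj₁ (remQuot {n} m y) ; h' = proj₂ (remQuot {n} m y)
  in (g ≡ g' × Adj H h h') ⊎ (h ≡ h' × Adj G g g')

_□_ : ∀ {n m} → Graph n → Graph m → Graph (n * m)
_□_ {n} {m} G H = record
  { Adj    = ProdAdj G H
  ; adj?   = λ x y → ((proj₁ (remQuot {n} m x) Fin.≟ proj₁ (remQuot {n} m y)) ×-dec adj? H _ _)
                     ⊎-dec ((proj₂ (remQuot {n} m x) Fin.≟ proj₂ (remQuot {n} m y)) ×-dec adj? G _ _)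
  ; adj-sym = λ { (inj₁ (e , a)) → inj₁ (Relation.Binary.PropositionalEquality.sym e , Graph.adj-sym H a)
               ; (inj₂ (e , a)) → inj₂ (Relation.Binary.PropositionalEquality.sym e , Graph.adj-sym G a) }
  ; irrefl = λ { (inj₁ (_ , a)) → irrefl H a ; (inj₂ (_ , a)) → irrefl G a }
  }

Config : ℕ → Set
Config n = Fin n → ℕ

size : ∀ {n} → Config n → ℕ
size {n} C = total n C

move : ∀ {n} → Config n → Fin n → Fin n → Config n
move C v w x =
  if ⌊ x Fin.≟ v ⌋ then C x ∸ 2 else (if ⌊ x Fin.≟ w ⌋ then suc (C x) else C x)

data Step {n} (G : Graph n) : Config n → Config n → Set where
  step : ∀ {C} v w → Adj G v w → 2 ≤ C v → Step G C (move C v w)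

Solvable-at : ∀ {n} → Graph n → Config n → Fin n → Set
Solvable-at G C r = ∃ λ D → Star (Step G) C D × 1 ≤ D r

Solvable : ∀ {n} → Graph n → Config n → Set
Solvable G C = ∀ r → Solvable-at G C r

IsPebblingNumber : ∀ {n} → Graph n → ℕ → Set
IsPebblingNumber {n} G k =
  (∀ (C : Config n) → size C ≡ k → Solvable G C) ×
  (∀ j → j < k → ¬ (∀ (C : Config n) → size C ≡ j → Solvable G C))

Class0 : ∀ {n} → Graph n → Set
Class0 {n} G = IsPebblingNumber G n

{-# OPTIONS --safe #-}
-- Write m(v) = ⌊C(v)/2⌋ for the number of pebbles v can send along an edge, M for the sum of
-- all m(v), and U for the set of vertices without a pebble; since |C| = |V|, |U| ≤ 2M. Put
-- q = ⌊n/δ⌋. Then G and H have diameter at most 3q, so L = 2^(6q) pebbles on one vertex suffice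
-- to reach the root.
--
-- For a vertex (a , b), let every vertex (g , h) with h ~ b send m(g , h) pebbles along its row to
-- (g , b), and then let every (g , b) with g ~ a send half of its pebbles to (a , b). If L pebbles
-- arrive at some (a , b), we are done. Otherwise summing the arrivals over all (a , b) gives
-- δ²M ≤ 2Ln² + n|U|, and the hypothesis on δ turns this into |U| < δ. In that case some column
-- next to a vertex carrying two pebbles and some row next to the root are entirely occupied, so a
-- simple path of occupied vertices leads to the root and a pebble can be pushed along it.

module Submission where

open import Defs
open import Data.Nat using (ℕ; zero; suc; _+_; _*_; _^_; _≤_; _<_; _⊓_; ⌊_/2⌋; _≤?_; z≤n; s≤s; NonZero; >-nonZero)
open import Data.Nat.Properties
open import Data.Nat.DivMod using (_/_; _%_; m/n*n≤m; m≡m%n+[m/n]*n; m%n<n)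
open import Data.Nat.Tactic.RingSolver using (solve-∀)
open import Data.Fin using (Fin; combine; _↑ˡ_; _↑ʳ_; fromℕ<)
import Data.Fin as Fin
open import Data.Fin.Properties using (any?; all?; remQuot-combine; combine-surjective; ¬∀⟶∃¬)
open import Data.Bool using (if_then_else_)
open import Data.Product using (∃; _×_; _,_; proj₁; proj₂)
open import Data.Sum using (_⊎_; inj₁; inj₂)
open import Data.List using (List; []; _∷_)
open import Data.List.Membership.Propositional using (_∈_; _∉_)
open import Data.List.Relation.Unary.Any using (here; there)
import Data.List.Membership.DecPropositional as DecMembership
open import Function using (_∘_)
open import Relation.Nullary using (¬_; Dec; yes; no; contradiction)
open import Relation.Nullary.Decidable using (⌊_⌋; _×-dec_; _⊎-dec_)
open import Relation.Binary.PropositionalEquality using (_≡_; refl; sym; trans; cong; cong₂; subst; subst₂)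
open import Relation.Binary.Construct.Closure.ReflexiveTransitive using (Star; ε; _◅_; _◅◅_)
import Algebra.Properties.CommutativeMonoid.Sum +-0-commutativeMonoid as Sum
import Algebra.Properties.Semiring.Sum +-*-semiring as SemiringSum

-- Finite sums

total≡sum : ∀ {n} (f : Fin n → ℕ) → total n f ≡ Sum.sum f
total≡sum {zero}  f = refl
total≡sum {suc n} f = cong (f Fin.zero +_) (total≡sum (f ∘ Fin.suc))

total-cong : ∀ {n} {f g : Fin n → ℕ} → (∀ i → f i ≡ g i) → total n f ≡ total n g
total-cong {zero}  f≗g = refl
total-cong {suc n} f≗g = cong₂ _+_ (f≗g Fin.zero) (total-cong (f≗g ∘ Fin.suc))

total-mono : ∀ {n} {f g : Fin n → ℕ} → (∀ i → f i ≤ g i) → total n f ≤ total n g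
total-mono {zero}  f≤g = z≤n
total-mono {suc n} f≤g = +-mono-≤ (f≤g Fin.zero) (total-mono (f≤g ∘ Fin.suc))

total-+ : ∀ {n} (f g : Fin n → ℕ) → total n (λ i → f i + g i) ≡ total n f + total n g
total-+ f g = trans (total≡sum λ i → f i + g i)
  (trans (Sum.∑-distrib-+ f g) (sym (cong₂ _+_ (total≡sum f) (total≡sum g))))

total-*ˡ : ∀ {n} k (f : Fin n → ℕ) → total n (λ i → k * f i) ≡ k * total n f
total-*ˡ k f = trans (total≡sum λ i → k * f i)
  (trans (sym (SemiringSum.*-distribˡ-sum k f)) (cong (k *_) (sym (total≡sum f))))

total-*ʳ : ∀ {n} k (f : Fin n → ℕ) → total n (λ i → f i * k) ≡ total n f * k
total-*ʳ k f = trans (total-cong λ i → *-comm (f i) k) (trans (total-*ˡ k f) (*-comm k (total _ f)))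

total-swap : ∀ {m n} (f : Fin m → Fin n → ℕ) →
  total m (λ i → total n (f i)) ≡ total n (λ j → total m (λ i → f i j))
total-swap f = trans (total-sum f) (trans (Sum.∑-comm f) (sym (total-sum λ j i → f i j)))
  where
  total-sum : ∀ {m n} (f : Fin m → Fin n → ℕ) →
    total m (λ i → total n (f i)) ≡ Sum.sum (λ i → Sum.sum (f i))
  total-sum f = trans (total-cong λ i → total≡sum (f i)) (total≡sum λ i → Sum.sum (f i))

total-const : ∀ n k → total n (λ _ → k) ≡ n * k
total-const zero    k = refl
total-const (suc n) k = cong (k +_) (total-const n k)

term≤total : ∀ {n} (f : Fin n → ℕ) i → f i ≤ total n f
term≤total f Fin.zero    = m≤m+n _ _
term≤total f (Fin.suc i) = ≤-trans (term≤total (f ∘ Fin.suc) i) (m≤n+m _ _)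

-- Averaging: this is how the vertex with two pebbles, the full column and the full row are found.
total-<⇒∃< : ∀ {n} {f g : Fin n → ℕ} → total n f < total n g → ∃ λ i → f i < g i
total-<⇒∃< {n} {f} {g} f<g with any? (λ i → suc (f i) ≤? g i)
... | yes found = found
... | no ¬found = contradiction (total-mono λ i → ≮⇒≥ (λ lt → ¬found (i , lt))) (<⇒≱ f<g)

total-++ : ∀ m k (f : Fin (m + k) → ℕ) →
  total (m + k) f ≡ total m (λ i → f (i ↑ˡ k)) + total k (λ i → f (m ↑ʳ i))
total-++ zero    k f = refl
total-++ (suc m) k f = trans (cong (f Fin.zero +_) (total-++ m k (f ∘ Fin.suc)))
                             (sym (+-assoc (f Fin.zero) _ _))

total-combine : ∀ n m (f : Fin (n * m) → ℕ) →
  total (n * m) f ≡ total n (λ i → total m (λ j → f (combine i j)))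
total-combine zero    m f = refl
total-combine (suc n) m f = trans (total-++ m (n * m) f)
  (cong (total m (λ j → f (j ↑ˡ (n * m))) +_) (total-combine n m (λ i → f (m ↑ʳ i))))

-- Indicators and halves

𝟙 : ∀ {P : Set} → Dec P → ℕ
𝟙 d = if ⌊ d ⌋ then 1 else 0

𝟙≤1 : ∀ {P : Set} (p : Dec P) → 𝟙 p ≤ 1
𝟙≤1 (yes _) = ≤-refl
𝟙≤1 (no _)  = z≤n

𝟙-mono : ∀ {P Q : Set} (p : Dec P) (q : Dec Q) → (P → Q) → 𝟙 p ≤ 𝟙 q
𝟙-mono (no _)  _       _ = z≤n
𝟙-mono (yes _) (yes _) _ = ≤-refl
𝟙-mono (yes p) (no ¬q) f = contradiction (f p) ¬q

𝟙-disjoint : ∀ {P Q R : Set} (p : Dec P) (q : Dec Q) (r : Dec R) →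
  (P → R) → (Q → R) → (P → ¬ Q) → 𝟙 p + 𝟙 q ≤ 𝟙 r
𝟙-disjoint (yes p) (yes q) r       _ _ d = contradiction q (d p)
𝟙-disjoint (yes p) (no _)  r       f _ _ = 𝟙-mono (yes p) r f
𝟙-disjoint (no _)  q       r       _ g _ = 𝟙-mono q r g

minOver≤ : ∀ {n} (f : Fin n → ℕ) i → minOver n f ≤ f i
minOver≤ {suc zero}    f Fin.zero    = ≤-refl
minOver≤ {suc (suc n)} f Fin.zero    = m⊓n≤m _ _
minOver≤ {suc (suc n)} f (Fin.suc i) = ≤-trans (m⊓n≤n (f Fin.zero) _) (minOver≤ (f ∘ Fin.suc) i)

n≤1+2⌊n/2⌋ : ∀ n → n ≤ 1 + 2 * ⌊ n /2⌋
n≤1+2⌊n/2⌋ zero          = z≤n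
n≤1+2⌊n/2⌋ (suc zero)    = ≤-refl
n≤1+2⌊n/2⌋ (suc (suc n)) = subst (suc (suc n) ≤_)
  (cong suc (sym (*-suc 2 ⌊ n /2⌋))) (s≤s (s≤s (n≤1+2⌊n/2⌋ n)))

n≤2⌈n/2⌉ : ∀ n → n ≤ 2 * ⌊ suc n /2⌋
n≤2⌈n/2⌉ zero          = z≤n
n≤2⌈n/2⌉ (suc zero)    = s≤s z≤n
n≤2⌈n/2⌉ (suc (suc n)) = subst (suc (suc n) ≤_)
  (sym (*-suc 2 ⌊ suc n /2⌋)) (s≤s (s≤s (n≤2⌈n/2⌉ n)))

2⌊n/2⌋≤n : ∀ n → 2 * ⌊ n /2⌋ ≤ n
2⌊n/2⌋≤n zero          = z≤n
2⌊n/2⌋≤n (suc zero)    = z≤n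
2⌊n/2⌋≤n (suc (suc n)) = subst (_≤ suc (suc n)) (sym (*-suc 2 ⌊ n /2⌋)) (s≤s (s≤s (2⌊n/2⌋≤n n)))

-- Balls in graphs

-- Distance at most `k`. Walks grow at their far end, so `travel` can peel off the last edge.
Within : ∀ {n} → Graph n → Fin n → ℕ → Fin n → Set
Within G u zero    v = u ≡ v
Within G u (suc k) v = Within G u k v ⊎ ∃ λ w → Within G u k w × Adj G w v

within? : ∀ {n} (G : Graph n) u k v → Dec (Within G u k v)
within? G u zero    v = u Fin.≟ v
within? G u (suc k) v = within? G u k v ⊎-dec any? (λ w → within? G u k w ×-dec adj? G w v)

within-self : ∀ {n} (G : Graph n) u k → Within G u k u
within-self G u zero    = refl
within-self G u (suc k) = inj₁ (within-self G u k)

module _ {n} (G : Graph n) {δ : ℕ} (δ≤deg : ∀ v → δ ≤ degree G v) where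

  -- Follow the walk to its first vertex outside the ball: the predecessor is still inside, so that
  -- vertex is at distance exactly `k + 1`.
  ball-exit : ∀ u k {x z} → Within G u k x → Star (Adj G) x z → ¬ Within G u k z →
    ∃ λ y → ¬ Within G u k y × Within G u (suc k) y
  ball-exit u k x∈ ε x∉ = contradiction x∈ x∉
  ball-exit u k x∈ (_◅_ {j = y} e p) z∉ with within? G u k y
  ... | yes y∈ = ball-exit u k y∈ p z∉
  ... | no  y∉ = y , y∉ , inj₂ (_ , x∈ , e)

  -- A vertex at distance exactly 3 + 3j from u has all its neighbours at distance between
  -- 2 + 3j and 4 + 3j.
  ball-growth : Connected G → ∀ u j → (∀ v → Within G u (j * 3) v) ⊎
    (suc j * δ ≤ total n (λ v → 𝟙 (within? G u (suc (j * 3)) v)))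
  ball-growth _ u zero = inj₂ (begin
    1 * δ                                   ≡⟨ *-identityˡ δ ⟩
    δ                                       ≤⟨ δ≤deg u ⟩
    degree G u                              ≤⟨ total-mono (λ v → 𝟙-mono (adj? G u v) (within? G u 1 v)
                                                 (λ a → inj₂ (u , refl , a))) ⟩
    total n (λ v → 𝟙 (within? G u 1 v))     ∎)
    where open ≤-Reasoning
  ball-growth connected u (suc j) with ball-growth connected u j
  ... | inj₁ all = inj₁ (λ v → inj₁ (inj₁ (inj₁ (all v))))
  -- Radius `2 + 3j` is tested because a vertex outside that ball has no neighbour within distance
  -- `1 + 3j`.
  ... | inj₂ big with all? (within? G u (2 + j * 3))
  ...   | yes all = inj₁ (λ v → inj₁ (all v))
  ...   | no ¬all with ¬∀⟶∃¬ n _ (within? G u (2 + j * 3)) ¬all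
  ...     | z , z∉ with ball-exit u (2 + j * 3) (within-self G u (2 + j * 3)) (connected u z) z∉
  ...       | y , y∉ , y∈ = inj₂ (begin
    δ + suc j * δ                         ≤⟨ +-mono-≤ (δ≤deg y) big ⟩
    degree G y + total n (λ v → 𝟙 (within? G u (1 + j * 3) v))
                                          ≡⟨ +-comm (degree G y) _ ⟩
    total n (λ v → 𝟙 (within? G u (1 + j * 3) v)) + degree G y
                                          ≡⟨ total-+ (λ v → 𝟙 (within? G u (1 + j * 3) v)) (λ v → 𝟙 (adj? G y v)) ⟨
    total n (λ v → 𝟙 (within? G u (1 + j * 3) v) + 𝟙 (adj? G y v))
                                          ≤⟨ total-mono (λ v → 𝟙-disjoint
                                               (within? G u (1 + j * 3) v) (adj? G y v) (within? G u (4 + j * 3) v)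
                                               (λ v∈ → inj₁ (inj₁ (inj₁ v∈)))
                                               (λ a → inj₂ (y , y∈ , a))
                                               (λ v∈ a → y∉ (inj₂ (v , v∈ , adj-sym G a)))) ⟩
    total n (λ v → 𝟙 (within? G u (4 + j * 3) v)) ∎)
    where open ≤-Reasoning

  -- Otherwise `ball-growth` would exhibit at least `(q + 1) * δ` vertices, more than the graph has.
  diameter-bound : Connected G → ∀ q → n < suc q * δ → ∀ u v → Within G u (q * 3) v
  diameter-bound connected q n<[1+q]δ u with ball-growth connected u q
  ... | inj₁ all = all
  ... | inj₂ big = contradiction
    (≤-trans big (≤-trans (total-mono λ v → 𝟙≤1 (within? G u (suc (q * 3)) v))
                          (≤-reflexive (trans (total-const n 1) (*-identityʳ n)))))
    (<⇒≱ n<[1+q]δ)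

  -- Exchange the sums: `f g` is counted once for each neighbour `a` of `g`, hence at least `δ`
  -- times.
  double-count : (f : Fin n → ℕ) →
    δ * total n f ≤ total n (λ a → total n (λ g → 𝟙 (adj? G g a) * f g))
  double-count f = begin
    δ * total n f                                            ≡⟨ total-*ˡ δ f ⟨
    total n (λ g → δ * f g)                                  ≤⟨ total-mono (λ g → *-monoˡ-≤ (f g) (δ≤deg g)) ⟩
    total n (λ g → degree G g * f g)                         ≡⟨ total-cong (λ g → sym (total-*ʳ (f g) (λ a → 𝟙 (adj? G g a)))) ⟩
    total n (λ g → total n (λ a → 𝟙 (adj? G g a) * f g))     ≡⟨ total-swap (λ g a → 𝟙 (adj? G g a) * f g) ⟩
    total n (λ a → total n (λ g → 𝟙 (adj? G g a) * f g))     ∎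
    where open ≤-Reasoning

-- Pebbling up to leftover pebbles

infixl 6 _⊕_
infix  4 _≼_

_≼_ : ∀ {N} → Config N → Config N → Set
C ≼ D = ∀ x → C x ≤ D x

_⊕_ : ∀ {N} → Config N → Config N → Config N
(C ⊕ D) x = C x + D x

pile : ∀ {N} → Fin N → ℕ → Config N
pile v k x = if ⌊ x Fin.≟ v ⌋ then k else 0

pile-self : ∀ {N} (v : Fin N) k → pile v k v ≡ k
pile-self v k with v Fin.≟ v
... | yes _  = refl
... | no v≢v = contradiction refl v≢v

pile-+ : ∀ {N} (v : Fin N) j k x → pile v (j + k) x ≡ pile v j x + pile v k x
pile-+ v j k x with x Fin.≟ v
... | yes _ = refl
... | no _  = refl

pile-mono : ∀ {N} (v : Fin N) {j k} → j ≤ k → pile v j ≼ pile v k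
pile-mono v j≤k x with x Fin.≟ v
... | yes _ = j≤k
... | no _  = z≤n

pile-≼ : ∀ {N} (v : Fin N) {k} {C : Config N} → k ≤ C v → pile v k ≼ C
pile-≼ v k≤ x with x Fin.≟ v
... | yes refl = k≤
... | no _     = z≤n

pile-total : ∀ {N m} (v : Fin N) (k : Fin m → ℕ) x → pile v (total m k) x ≡ total m (λ i → pile v (k i) x)
pile-total {m = m} v k x with x Fin.≟ v
... | yes _ = refl
... | no _  = sym (trans (total-const m 0) (*-zeroʳ m))

-- A configuration is the superposition of its one-vertex piles, so `⇝-total` can move it pile by
-- pile.
total-pile : ∀ {N} (C : Config N) x → total N (λ v → pile v (C v) x) ≡ C x
total-pile {suc N} C Fin.zero    =
  trans (cong (C Fin.zero +_) (trans (total-const N 0) (*-zeroʳ N))) (+-identityʳ _)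
total-pile {suc N} C (Fin.suc x) = trans (total-cong same) (total-pile (C ∘ Fin.suc) x)
  where
  same : ∀ v → pile (Fin.suc v) (C (Fin.suc v)) (Fin.suc x) ≡ pile v (C (Fin.suc v)) x
  same v with x Fin.≟ v
  ... | yes _ = refl
  ... | no _  = refl

module Pebbling {N} (Γ : Graph N) where

  infix 4 _⇝_

  -- Surplus pebbles may be forgotten, so only lower bounds are tracked, and pointwise comparison
  -- replaces equality of configurations as functions.
  _⇝_ : Config N → Config N → Set
  C ⇝ D = ∃ λ D′ → Star (Step Γ) C D′ × D ≼ D′

  ≽⇒⇝ : ∀ {C D} → D ≼ C → C ⇝ D
  ≽⇒⇝ D≼C = _ , ε , D≼C

  move-mono : ∀ {C D : Config N} v w → C ≼ D → move C v w ≼ move D v w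
  move-mono v w C≼D x with x Fin.≟ v
  ... | yes _ = ∸-monoˡ-≤ 2 (C≼D x)
  ... | no _ with x Fin.≟ w
  ...   | yes _ = s≤s (C≼D x)
  ...   | no _  = C≼D x

  -- Extra pebbles keep every step legal, and each step preserves the comparison.
  star-mono : ∀ {C D C′} → Star (Step Γ) C D → C ≼ C′ → C′ ⇝ D
  star-mono ε C≼C′ = ≽⇒⇝ C≼C′
  star-mono (step v w a 2≤ ◅ s) C≼C′ with star-mono s (move-mono v w C≼C′)
  ... | D′ , s′ , D≼D′ = D′ , step v w a (≤-trans 2≤ (C≼C′ v)) ◅ s′ , D≼D′

  ⇝-trans : ∀ {C D E} → C ⇝ D → D ⇝ E → C ⇝ E
  ⇝-trans (D′ , s , D≼D′) (E′ , t , E≼E′) with star-mono t D≼D′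
  ... | E″ , t′ , E′≼E″ = E″ , s ◅◅ t′ , λ x → ≤-trans (E≼E′ x) (E′≼E″ x)

  ≽-trans : ∀ {C D E} → D ≼ C → D ⇝ E → C ⇝ E
  ≽-trans D≼C = ⇝-trans (≽⇒⇝ D≼C)

  move-⊕ : ∀ (C E : Config N) v w → 2 ≤ C v → move C v w ⊕ E ≼ move (C ⊕ E) v w
  move-⊕ C E v w 2≤ x with x Fin.≟ v
  -- `2 ≤ C v` keeps the truncated subtraction exact.
  ... | yes refl = ≤-reflexive (sym (+-∸-comm (E v) 2≤))
  ... | no _ with x Fin.≟ w
  ...   | yes _ = ≤-refl
  ...   | no _  = ≤-refl

  ⇝-frame : ∀ {C D} E → Star (Step Γ) C D → C ⊕ E ⇝ D ⊕ E
  ⇝-frame E ε = ≽⇒⇝ (λ _ → ≤-refl)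
  ⇝-frame {C} E (step v w a 2≤ ◅ s) =
    ⇝-trans (_ , step v w a (≤-trans 2≤ (m≤m+n (C v) (E v))) ◅ ε , move-⊕ C E v w 2≤) (⇝-frame E s)

  ⇝-frameʳ : ∀ {C D} E → C ⇝ D → C ⊕ E ⇝ D ⊕ E
  ⇝-frameʳ E (D′ , s , D≼D′) = ⇝-trans (⇝-frame E s) (≽⇒⇝ λ x → +-monoˡ-≤ (E x) (D≼D′ x))

  -- The two runs take place one after the other, each leaving the other's pebbles alone.
  ⇝-⊕ : ∀ {C C′ D D′} → C ⇝ C′ → D ⇝ D′ → C ⊕ D ⇝ C′ ⊕ D′
  ⇝-⊕ {C} {C′} {D} {D′} c d =
    ⇝-trans (⇝-frameʳ D c) (≽-trans (λ x → ≤-reflexive (+-comm (D x) (C′ x)))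
      (⇝-trans (⇝-frameʳ C′ d) (≽⇒⇝ λ x → ≤-reflexive (+-comm (C′ x) (D′ x)))))

  ⇝-total : ∀ {m} {F F′ : Fin m → Config N} → (∀ i → F i ⇝ F′ i) →
    (λ x → total m (λ i → F i x)) ⇝ (λ x → total m (λ i → F′ i x))
  ⇝-total {zero}  F⇝F′ = ≽⇒⇝ (λ _ → z≤n)
  ⇝-total {suc m} F⇝F′ = ⇝-⊕ (F⇝F′ Fin.zero) (⇝-total (F⇝F′ ∘ Fin.suc))

  move-one : ∀ {v w} → Adj Γ v w → pile v 2 ⇝ pile w 1
  move-one {v} {w} a = _ , step v w a (≤-reflexive (sym (pile-self v 2))) ◅ ε , arrived
    where
    arrived : pile w 1 ≼ move (pile v 2) v w
    arrived x with x Fin.≟ v | x Fin.≟ w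
    ... | yes refl | yes refl = contradiction a (irrefl Γ)
    ... | yes _    | no _     = z≤n
    ... | no _     | yes _    = s≤s z≤n
    ... | no _     | no _     = z≤n

  move-pile : ∀ {v w} → Adj Γ v w → ∀ k → pile v (2 * k) ⇝ pile w k
  move-pile {v} {w} a zero    = ≽⇒⇝ (pile-≼ w z≤n)
  move-pile {v} {w} a (suc k) =
    ≽-trans (λ x → ≤-reflexive (trans (sym (pile-+ v 2 (2 * k) x)) (cong (λ j → pile v j x) (sym (*-suc 2 k)))))
      (⇝-trans (⇝-⊕ (move-one a) (move-pile a k)) (≽⇒⇝ λ x → ≤-reflexive (pile-+ w 1 k x)))

  move-half : ∀ {v w} → Adj Γ v w → ∀ k → pile v k ⇝ pile w ⌊ k /2⌋
  move-half {v} a k = ≽-trans (pile-mono v (2⌊n/2⌋≤n k)) (move-pile a ⌊ k /2⌋)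

  -- Every edge halves the number of pebbles; if the target is closer than `k`, the surplus is
  -- dropped.
  travel : ∀ {u v} k → Within Γ u k v → ∀ c → pile u (2 ^ k * c) ⇝ pile v c
  travel {u} zero    refl     c = ≽⇒⇝ (pile-mono u (≤-reflexive (sym (*-identityˡ c))))
  travel {u} (suc k) (inj₁ p) c =
    ≽-trans (pile-mono u (*-monoˡ-≤ c (m≤m+n (2 ^ k) _))) (travel k p c)
  travel {u} (suc k) (inj₂ (w , p , a)) c =
    ≽-trans (pile-mono u (≤-reflexive (lemma (2 ^ k) c))) (⇝-trans (travel k p (2 * c)) (move-pile a c))
    where
    lemma : ∀ t c → t * (2 * c) ≡ 2 * t * c
    lemma = solve-∀

  ⇝-solves : ∀ {C} r → C ⇝ pile r 1 → Solvable-at Γ C r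
  ⇝-solves r (D , s , ≼D) = D , s , subst (_≤ D r) (pile-self r 1) (≼D r)

  -- The list records the vertices departed from, which are distinct and occupied. The endpoint `r`
  -- is left out, since it may be empty.
  data OccupiedPath (C : Config N) (r : Fin N) : Fin N → List (Fin N) → Set where
    done : OccupiedPath C r r []
    cons : ∀ {u w ws} → Adj Γ u w → 1 ≤ C u → u ∉ ws → OccupiedPath C r w ws → OccupiedPath C r u (u ∷ ws)

  module _ {C : Config N} {r : Fin N} where

    suffix : ∀ {u w ws} → OccupiedPath C r w ws → u ∈ ws → ∃ λ ws′ → OccupiedPath C r u ws′
    suffix p@(cons _ _ _ _) (here refl) = _ , p
    suffix (cons _ _ _ p)   (there u∈)  = suffix p u∈

    -- If `u` already lies on the path, its suffix from `u` is taken instead, so no vertex is listed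
    -- twice.
    extend : ∀ {u w} → Adj Γ u w → 1 ≤ C u → (∃ λ ws → OccupiedPath C r w ws) → ∃ λ ws → OccupiedPath C r u ws
    extend {u} a 1≤ (ws , p) with DecMembership._∈?_ Fin._≟_ u ws
    ... | yes u∈ = suffix p u∈
    ... | no  u∉ = _ , cons a 1≤ u∉ p

    singles : List (Fin N) → Config N
    singles []       = λ _ → 0
    singles (w ∷ ws) = pile w 1 ⊕ singles ws

    -- The travelling pebble joins the single pebble reserved on `u`; the pair pays for a step,
    -- which puts a travelling pebble on `w`.
    push : ∀ {u ws} → OccupiedPath C r u ws → pile u 1 ⊕ singles ws ⇝ pile r 1
    push done = ≽⇒⇝ (λ x → m≤m+n _ 0)
    push (cons {u} {w} {ws} a _ _ p) =
      ≽-trans (λ x → ≤-reflexive (trans (cong (_+ singles ws x) (pile-+ u 1 1 x)) (+-assoc (pile u 1 x) _ _)))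
        (⇝-trans (⇝-frameʳ (singles ws) (move-one a)) (push p))

    singles-∉ : ∀ ws {x} → x ∉ ws → singles ws x ≡ 0
    singles-∉ []       x∉ = refl
    singles-∉ (w ∷ ws) {x} x∉ with x Fin.≟ w
    ... | yes refl = contradiction (here refl) x∉
    ... | no _     = singles-∉ ws (x∉ ∘ there)

    singles-≼ : ∀ {u ws} → OccupiedPath C r u ws → singles ws ≼ C
    singles-≼ done x = z≤n
    singles-≼ (cons {u} {w} {ws} _ 1≤ u∉ p) x with x Fin.≟ u
    ... | yes refl = subst (λ k → suc k ≤ C u) (sym (singles-∉ ws u∉)) 1≤
    ... | no _     = singles-≼ p x

    -- As the listed vertices are distinct, each is charged one pebble, except that the start also
    -- supplies the travelling pebble.
    push-≼ : ∀ {u ws} → 2 ≤ C u → OccupiedPath C r u ws → pile u 1 ⊕ singles ws ≼ C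
    push-≼ {u} 2≤ done x = subst (_≤ C x) (sym (+-identityʳ _)) (pile-≼ u (≤-trans (s≤s z≤n) 2≤) x)
    push-≼ 2≤ (cons {u} {w} {ws} _ _ u∉ p) x with x Fin.≟ u
    ... | yes refl = subst (λ k → suc (suc k) ≤ C u) (sym (singles-∉ ws u∉)) 2≤
    ... | no _     = singles-≼ p x

    occupied-path-solves : ∀ {u} → 2 ≤ C u → (∃ λ ws → OccupiedPath C r u ws) → Solvable-at Γ C r
    occupied-path-solves 2≤ (_ , p) = ⇝-solves r (≽-trans (push-≼ 2≤ p) (push p))

-- Vacancies and rounding losses

vacant : ℕ → ℕ
vacant zero    = 1
vacant (suc _) = 0

vacant<1⇒occupied : ∀ c → vacant c < 1 → 1 ≤ c
vacant<1⇒occupied zero    (s≤s ())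
vacant<1⇒occupied (suc c) _ = s≤s z≤n

-- At most one pebble of a vertex stays unpaired. An empty vertex has none, and the constant 1 then
-- pays for its vacancy.
pebbles+vacant≤ : ∀ c → c + vacant c ≤ 1 + 2 * ⌊ c /2⌋
pebbles+vacant≤ zero    = ≤-refl
pebbles+vacant≤ (suc c) = subst (_≤ 1 + 2 * ⌊ suc c /2⌋) (sym (+-identityʳ (suc c))) (n≤1+2⌊n/2⌋ (suc c))

-- Only an initially empty vertex can waste one of the p pebbles arriving at it.
arrivals≤ : ∀ c p → p ≤ 2 * ⌊ c + p /2⌋ + vacant c
arrivals≤ zero    p = subst (p ≤_) (+-comm 1 _) (n≤1+2⌊n/2⌋ p)
arrivals≤ (suc c) p = ≤-trans (n≤2⌈n/2⌉ p)
  (≤-trans (*-monoʳ-≤ 2 (⌊n/2⌋-mono (s≤s (m≤n+m p c)))) (m≤m+n _ 0))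

-- Gathering pebbles in the product graph

module Grid {n} (G H : Graph n) where

  open Pebbling (G □ H)

  row-edge : ∀ g {h h′} → Adj H h h′ → Adj (G □ H) (combine g h) (combine g h′)
  row-edge g {h} {h′} a = inj₁
    ( trans (cong proj₁ (remQuot-combine g h)) (sym (cong proj₁ (remQuot-combine g h′)))
    , subst₂ (Adj H) (sym (cong proj₂ (remQuot-combine g h))) (sym (cong proj₂ (remQuot-combine g h′))) a)

  column-edge : ∀ {g g′} h → Adj G g g′ → Adj (G □ H) (combine g h) (combine g′ h)
  column-edge {g} {g′} h a = inj₂
    ( trans (cong proj₂ (remQuot-combine g h)) (sym (cong proj₂ (remQuot-combine g′ h)))
    , subst₂ (Adj G) (sym (cong proj₁ (remQuot-combine g h))) (sym (cong proj₁ (remQuot-combine g′ h))) a)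

  row-within : ∀ g k {h h′} → Within H h k h′ → Within (G □ H) (combine g h) k (combine g h′)
  row-within g zero    refl              = refl
  row-within g (suc k) (inj₁ p)          = inj₁ (row-within g k p)
  row-within g (suc k) (inj₂ (w , p , a)) = inj₂ (_ , row-within g k p , row-edge g a)

  column-within : ∀ h k {g g′} → Within G g k g′ → Within (G □ H) (combine g h) k (combine g′ h)
  column-within h zero    refl              = refl
  column-within h (suc k) (inj₁ p)          = inj₁ (column-within h k p)
  column-within h (suc k) (inj₂ (w , p , a)) = inj₂ (_ , column-within h k p , column-edge h a)

  module Gathering (C : Config (n * n)) where

    c m z : Fin n → Fin n → ℕ
    c g h = C (combine g h)
    m g h = ⌊ c g h /2⌋
    z g h = vacant (c g h)

    -- With this notation `T m` and `T z` are the M and |U| of the outline.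
    T : (Fin n → Fin n → ℕ) → ℕ
    T f = total n (λ g → total n (f g))

    T-mono : ∀ {f f′ : Fin n → Fin n → ℕ} → (∀ g h → f g h ≤ f′ g h) → T f ≤ T f′
    T-mono f≤f′ = total-mono (λ g → total-mono (f≤f′ g))

    T-+ : ∀ f f′ → T (λ g h → f g h + f′ g h) ≡ T f + T f′
    T-+ f f′ = trans (total-cong λ g → total-+ (f g) (f′ g)) (total-+ (λ g → total n (f g)) (λ g → total n (f′ g)))

    T-*ˡ : ∀ k f → T (λ g h → k * f g h) ≡ k * T f
    T-*ˡ k f = trans (total-cong λ g → total-*ˡ k (f g)) (total-*ˡ k (λ g → total n (f g)))

    T-const : ∀ k → T (λ _ _ → k) ≡ n * (n * k)
    T-const k = trans (total-cong {n} {f = λ _ → total n (λ _ → k)} {g = λ _ → n * k} λ _ → total-const n k) (total-const n (n * k))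

    -- The pebbles reaching (g , b) when row g sends as many as possible along its edges, and
    -- those then reaching (a , b) when column b does the same.
    P : Fin n → Fin n → ℕ
    P g b = total n (λ h → 𝟙 (adj? H h b) * m g h)

    Q : Fin n → Fin n → ℕ
    Q a b = total n (λ g → 𝟙 (adj? G g a) * ⌊ c g b + P g b /2⌋)

    gather-row : ∀ b → C ⇝ (λ x → total n (λ g → pile (combine g b) (c g b + P g b) x))
    gather-row b = ≽-trans (λ x → ≤-reflexive (spread x)) (⇝-total λ g →
      ⇝-trans (⇝-total (λ h → send g h)) (≽⇒⇝ (λ x → ≤-reflexive (collect g x))))
      where
      open ≤-Reasoning

      -- `pile h (c g h) b` acts as a Kronecker delta: the pile with `h = b` stays, neighbours of
      -- `b` send their pairs, and other piles are dropped.
      k : Fin n → Fin n → ℕ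
      k g h = pile h (c g h) b + 𝟙 (adj? H h b) * m g h

      spread : ∀ x → T (λ g h → pile (combine g h) (c g h) x) ≡ C x
      spread x = trans (sym (total-combine n n (λ v → pile v (C v) x))) (total-pile C x)

      send : ∀ g h → pile (combine g h) (c g h) ⇝ pile (combine g b) (k g h)
      send g h with b Fin.≟ h | adj? H h b
      ... | yes refl | yes a = contradiction a (irrefl H)
      ... | yes refl | no _  = ≽⇒⇝ (pile-mono (combine g h) (≤-reflexive (+-identityʳ _)))
      ... | no _     | yes a = ⇝-trans (move-half (row-edge g a) (c g h))
                                       (≽⇒⇝ (pile-mono (combine g b) (≤-reflexive (+-identityʳ _))))
      ... | no _     | no _  = ≽⇒⇝ (pile-≼ (combine g b) z≤n)

      collect : ∀ g x → pile (combine g b) (c g b + P g b) x ≡ total n (λ h → pile (combine g b) (k g h) x)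
      collect g x = trans (cong (λ j → pile (combine g b) j x)
        (sym (trans (total-+ (λ h → pile h (c g h) b) (λ h → 𝟙 (adj? H h b) * m g h))
                    (cong (_+ P g b) (total-pile (c g) b)))))
        (pile-total (combine g b) (k g) x)

    gather : ∀ a b → C ⇝ pile (combine a b) (Q a b)
    gather a b = ⇝-trans (gather-row b) (⇝-trans (⇝-total send)
      (≽⇒⇝ λ x → ≤-reflexive (pile-total (combine a b) k x)))
      where
      k : Fin n → ℕ
      k g = 𝟙 (adj? G g a) * ⌊ c g b + P g b /2⌋

      send : ∀ g → pile (combine g b) (c g b + P g b) ⇝ pile (combine a b) (k g)
      send g with adj? G g a
      ... | yes e = ⇝-trans (move-half (column-edge b e) (c g b + P g b))
                            (≽⇒⇝ (pile-mono (combine a b) (≤-reflexive (+-identityʳ _))))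
      ... | no _  = ≽⇒⇝ (pile-≼ (combine a b) z≤n)

    -- The gathered pebbles travel along column `b` to `(g₀ , b)` and then along row `g₀`; the costs
    -- of the two legs multiply.
    many-gathered : ∀ {a b} k l {g₀ h₀} → Within G a k g₀ → Within H b l h₀ →
      2 ^ k * 2 ^ l ≤ Q a b → Solvable-at (G □ H) C (combine g₀ h₀)
    many-gathered {a} {b} k l {g₀} {h₀} p q big = ⇝-solves _
      (⇝-trans (gather a b) (≽-trans (pile-mono (combine a b) big)
        (⇝-trans (travel k (column-within b k p) (2 ^ l))
          (≽-trans (pile-mono (combine g₀ b) (≤-reflexive (*-identityʳ (2 ^ l))))
            (travel l (row-within g₀ l q) 1)))))

    -- Sum `pebbles+vacant≤` over the grid: the pebbles on the left and the constants on the right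
    -- both amount to `n * n` and cancel.
    vacancies≤ : size C ≡ n * n → T z ≤ 2 * T m
    vacancies≤ size≡ = +-cancelˡ-≤ (n * n) _ _ (begin
      n * n + T z                        ≡⟨ cong (_+ T z) (trans (sym size≡) (total-combine n n C)) ⟩
      T c + T z                          ≡⟨ T-+ c z ⟨
      T (λ g h → c g h + z g h)          ≤⟨ T-mono (λ g h → pebbles+vacant≤ (c g h)) ⟩
      T (λ g h → 1 + 2 * m g h)          ≡⟨ T-+ (λ _ _ → 1) (λ g h → 2 * m g h) ⟩
      T (λ _ _ → 1) + T (λ g h → 2 * m g h)
                                         ≡⟨ cong₂ _+_ (T-const 1) (T-*ˡ 2 m) ⟩
      n * (n * 1) + 2 * T m              ≡⟨ cong (λ k → n * k + 2 * T m) (*-identityʳ n) ⟩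
      n * n + 2 * T m                    ∎)
      where open ≤-Reasoning

    -- Counting arrivals, and the case of few vacancies

    module _ {δ : ℕ} (δ≤degG : ∀ v → δ ≤ degree G v) (δ≤degH : ∀ v → δ ≤ degree H v) where

      -- Double counting in `H` and then in `G` gives the factor `δ` twice. By `arrivals≤`, the
      -- second halving wastes arriving pebbles only at vacancies.
      two-step-count : ∀ L → (∀ a b → Q a b ≤ L) → δ * (δ * T m) ≤ n * (n * (2 * L)) + n * T z
      two-step-count L Q≤L = begin
        δ * (δ * T m)                             ≡⟨ cong (δ *_) (total-*ˡ δ (λ g → total n (m g))) ⟨
        δ * total n (λ g → δ * total n (m g))     ≤⟨ *-monoʳ-≤ δ (total-mono λ g → double-count H δ≤degH (m g)) ⟩
        δ * T P                                   ≡⟨ cong (δ *_) (total-swap P) ⟩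
        δ * T (λ b g → P g b)                     ≡⟨ total-*ˡ δ (λ b → total n (λ g → P g b)) ⟨
        total n (λ b → δ * total n (λ g → P g b)) ≤⟨ total-mono (λ b → double-count G δ≤degG (λ g → P g b)) ⟩
        T (λ b a → total n (λ g → 𝟙 (adj? G g a) * P g b))
                                                  ≤⟨ T-mono (λ b a → at a b) ⟩
        T (λ b _ → 2 * L + Z b)                   ≡⟨ T-+ (λ _ _ → 2 * L) (λ b _ → Z b) ⟩
        T (λ _ _ → 2 * L) + T (λ b _ → Z b)       ≡⟨ cong₂ _+_ (T-const (2 * L)) TZ ⟩
        n * (n * (2 * L)) + n * T z               ∎
        where
        open ≤-Reasoning

        -- The loss at `(a , b)` is charged to all vacancies of column `b`. Each vacancy is thus
        -- charged once for every `a`, whence the factor `n` in `TZ`.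
        Z : Fin n → ℕ
        Z b = total n (λ g → z g b)

        TZ : T (λ b _ → Z b) ≡ n * T z
        TZ = trans (total-cong λ b → total-const n (Z b))
          (trans (total-*ˡ n Z) (cong (n *_) (sym (total-swap z))))

        edge : ∀ {i f p y} → i ≤ 1 → p ≤ 2 * f + y → i * p ≤ 2 * (i * f) + y
        edge {i} {f} {p} {y} i≤1 p≤ = begin
          i * p                     ≤⟨ *-monoʳ-≤ i p≤ ⟩
          i * (2 * f + y)           ≡⟨ lemma i f y ⟩
          2 * (i * f) + i * y       ≤⟨ +-monoʳ-≤ (2 * (i * f)) (*-monoˡ-≤ y i≤1) ⟩
          2 * (i * f) + 1 * y       ≡⟨ cong (2 * (i * f) +_) (*-identityˡ y) ⟩
          2 * (i * f) + y           ∎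
          where
          lemma : ∀ i f y → i * (2 * f + y) ≡ 2 * (i * f) + i * y
          lemma = solve-∀

        at : ∀ a b → total n (λ g → 𝟙 (adj? G g a) * P g b) ≤ 2 * L + Z b
        at a b = begin
          total n (λ g → 𝟙 (adj? G g a) * P g b)
            ≤⟨ total-mono (λ g → edge {f = ⌊ c g b + P g b /2⌋} (𝟙≤1 (adj? G g a)) (arrivals≤ (c g b) (P g b))) ⟩
          total n (λ g → 2 * (𝟙 (adj? G g a) * ⌊ c g b + P g b /2⌋) + z g b)
            ≡⟨ total-+ (λ g → 2 * (𝟙 (adj? G g a) * ⌊ c g b + P g b /2⌋)) (λ g → z g b) ⟩
          total n (λ g → 2 * (𝟙 (adj? G g a) * ⌊ c g b + P g b /2⌋)) + Z b
            ≡⟨ cong (_+ Z b) (total-*ˡ 2 (λ g → 𝟙 (adj? G g a) * ⌊ c g b + P g b /2⌋)) ⟩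
          2 * Q a b + Z b
            ≤⟨ +-monoˡ-≤ (Z b) (*-monoʳ-≤ 2 (Q≤L a b)) ⟩
          2 * L + Z b ∎

      -- If every column neighbouring `h` had a vacancy, there would be at least `degree H h ≥ δ`
      -- vacancies.
      full-column : T z < δ → ∀ h → ∃ λ h′ → Adj H h h′ × (∀ g → 1 ≤ c g h′)
      full-column Tz<δ h with total-<⇒∃< {g = λ h′ → 𝟙 (adj? H h h′)}
        (<-≤-trans (subst (_< δ) (total-swap z) Tz<δ) (δ≤degH h))
      ... | h′ , lt with adj? H h h′
      ...   | yes a = h′ , a , λ g → vacant<1⇒occupied (c g h′) (≤-<-trans (term≤total (λ g → z g h′) g) lt)
      ...   | no _  = contradiction lt (λ ())

      full-row : T z < δ → ∀ g → ∃ λ g′ → Adj G g g′ × (∀ h → 1 ≤ c g′ h)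
      full-row Tz<δ g with total-<⇒∃< {g = λ g′ → 𝟙 (adj? G g g′)} (<-≤-trans Tz<δ (δ≤degG g))
      ... | g′ , lt with adj? G g g′
      ...   | yes a = g′ , a , λ h → vacant<1⇒occupied (c g′ h) (≤-<-trans (term≤total (z g′) h) lt)
      ...   | no _  = contradiction lt (λ ())

      -- The empty root forces a vacancy, so `vacancies≤` yields some `(g , h)` with two pebbles.
      -- From there the path steps into the full column `h′`, follows it to the full row `g₁`,
      -- follows that to `(g₁ , h₀)`, and steps to the root.
      few-vacant : Connected G → Connected H → T z < δ → size C ≡ n * n → ∀ g₀ h₀ → c g₀ h₀ ≡ 0 → Solvable-at (G □ H) C (combine g₀ h₀)
      few-vacant connG connH Tz<δ size≡ g₀ h₀ c≡0 with total-<⇒∃< {f = λ _ → 0} {g = λ g → total n (m g)} 0<Tm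
        where
        0<Tz : 0 < T z
        0<Tz = ≤-trans (≤-trans (≤-reflexive (cong vacant (sym c≡0))) (term≤total (z g₀) h₀))
                       (term≤total (λ g → total n (z g)) g₀)
        0<Tm : total n (λ _ → 0) < T m
        0<Tm = subst (_< T m) (sym (trans (total-const n 0) (*-zeroʳ n)))
          (n≢0⇒n>0 (λ Tm≡0 → <⇒≱ 0<Tz (subst (T z ≤_) (cong (2 *_) Tm≡0) (vacancies≤ size≡))))
      ... | g , 0<mg with total-<⇒∃< {f = λ _ → 0} {g = m g}
                            (subst (_< total n (m g)) (sym (trans (total-const n 0) (*-zeroʳ n))) 0<mg)
      ...   | h , 0<m with full-column Tz<δ h | full-row Tz<δ g₀
      ...     | h′ , hh′ , column | g₁ , g₀g₁ , row =
        occupied-path-solves heavy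
          (extend (row-edge g hh′) (≤-trans (s≤s z≤n) heavy) (along-column (connG g g₁)))
        where
        heavy : 2 ≤ c g h
        heavy = ≤-trans (*-monoʳ-≤ 2 0<m) (2⌊n/2⌋≤n (c g h))

        Reaches : Fin (n * n) → Set
        Reaches u = ∃ λ ws → OccupiedPath C (combine g₀ h₀) u ws

        along-row : ∀ {j} → Star (Adj H) j h₀ → Reaches (combine g₁ j)
        along-row ε       = extend (column-edge h₀ (adj-sym G g₀g₁)) (row h₀) (_ , done)
        along-row (a ◅ s) = extend (row-edge g₁ a) (row _) (along-row s)

        along-column : ∀ {i} → Star (Adj G) i g₁ → Reaches (combine i h′)
        along-column ε       = along-row (connH h′ h₀)
        along-column (a ◅ s) = extend (column-edge h′ a) (column _) (along-column s)

      grid-solvable : Connected G → Connected H → ∀ q → n < suc q * δ → size C ≡ n * n →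
        4 * n ≤ δ * δ → 8 * (2 ^ (q * 3) * 2 ^ (q * 3)) * (n * n) < δ * δ * δ →
        ∀ g₀ h₀ → Solvable-at (G □ H) C (combine g₀ h₀)
      grid-solvable connG connH q n<[1+q]δ size≡ 4n≤δ² 8Ln²<δ³ g₀ h₀ with c g₀ h₀ in eq
      ... | suc k = C , ε , subst (1 ≤_) (sym eq) (s≤s z≤n)
      ... | zero with any? (λ a → any? (λ b → 2 ^ (q * 3) * 2 ^ (q * 3) ≤? Q a b))
      ...   | yes (a , b , big) = many-gathered (q * 3) (q * 3)
                (diameter-bound G δ≤degG connG q n<[1+q]δ a g₀)
                (diameter-bound H δ≤degH connH q n<[1+q]δ b h₀) big
      ...   | no ¬big = few-vacant connG connH (≰⇒> δ≰Tz) size≡ g₀ h₀ eq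
        where
        open ≤-Reasoning

        L = 2 ^ (q * 3) * 2 ^ (q * 3)

        count : δ * (δ * T m) ≤ n * (n * (2 * L)) + n * T z
        count = two-step-count L (λ a b → <⇒≤ (≰⇒> (λ big → ¬big (a , b , big))))

        lemma₁ : ∀ δ M → 2 * (δ * (δ * M)) ≡ δ * δ * M + δ * δ * M
        lemma₁ = solve-∀

        lemma₂ : ∀ n L M → 2 * (n * (n * (2 * L)) + n * (2 * M)) ≡ 4 * L * (n * n) + 4 * n * M
        lemma₂ = solve-∀

        -- After doubling `count`, the vacancy term is at most `4 * n * T m`, which `4n≤δ²` absorbs
        -- into one of the two copies of `δ * δ * T m`.
        δ²Tm≤ : δ * δ * T m ≤ 4 * L * (n * n)
        δ²Tm≤ = +-cancelʳ-≤ (δ * δ * T m) _ _ (begin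
          δ * δ * T m + δ * δ * T m                ≡⟨ lemma₁ δ (T m) ⟨
          2 * (δ * (δ * T m))                      ≤⟨ *-monoʳ-≤ 2 count ⟩
          2 * (n * (n * (2 * L)) + n * T z)        ≤⟨ *-monoʳ-≤ 2 (+-monoʳ-≤ (n * (n * (2 * L))) (*-monoʳ-≤ n (vacancies≤ size≡))) ⟩
          2 * (n * (n * (2 * L)) + n * (2 * T m))  ≡⟨ lemma₂ n L (T m) ⟩
          4 * L * (n * n) + 4 * n * T m            ≤⟨ +-monoʳ-≤ (4 * L * (n * n)) (*-monoˡ-≤ (T m) 4n≤δ²) ⟩
          4 * L * (n * n) + δ * δ * T m            ∎)

        lemma₃ : ∀ d M → d * (2 * M) ≡ 2 * (d * M)
        lemma₃ = solve-∀

        lemma₄ : ∀ L k → 2 * (4 * L * k) ≡ 8 * L * k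
        lemma₄ = solve-∀

        -- `δ ≤ T z ≤ 2 * T m` would turn the previous bound into one on `δ * δ * δ`.
        δ≰Tz : ¬ (δ ≤ T z)
        δ≰Tz δ≤Tz = <⇒≱ 8Ln²<δ³ (begin
          δ * δ * δ              ≤⟨ *-monoʳ-≤ (δ * δ) (≤-trans δ≤Tz (vacancies≤ size≡)) ⟩
          δ * δ * (2 * T m)      ≡⟨ lemma₃ (δ * δ) (T m) ⟩
          2 * (δ * δ * T m)      ≤⟨ *-monoʳ-≤ 2 δ²Tm≤ ⟩
          2 * (4 * L * (n * n))  ≡⟨ lemma₄ L (n * n) ⟩
          8 * L * (n * n)        ∎)

-- Configurations with at most one pebble per vertex

ones : ∀ {N} → ℕ → Config N
ones zero    _           = 0
ones (suc j) Fin.zero    = 1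
ones (suc j) (Fin.suc i) = ones j i

size-ones : ∀ {N j} → j ≤ N → size {N} (ones j) ≡ j
size-ones {N} {zero}  _         = trans (total-const N 0) (*-zeroʳ N)
size-ones {suc N} {suc j} (s≤s j≤N) = cong suc (size-ones j≤N)

ones≤1 : ∀ {N} j (i : Fin N) → ones j i ≤ 1
ones≤1 zero    i           = z≤n
ones≤1 (suc j) Fin.zero    = ≤-refl
ones≤1 (suc j) (Fin.suc i) = ones≤1 j i

ones-fromℕ< : ∀ {N j} (j<N : j < N) → ones j (fromℕ< j<N) ≡ 0
ones-fromℕ< {suc N} {zero}  _         = refl
ones-fromℕ< {suc N} {suc j} (s≤s j<N) = ones-fromℕ< j<N

-- Put one pebble on each of the first `j` vertices: no step is legal, and the next vertex stays
-- empty.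
pebbling-number≥order : ∀ {N} (Γ : Graph N) j → j < N → ¬ (∀ C → size C ≡ j → Solvable Γ C)
pebbling-number≥order Γ j j<N solvable with solvable (ones j) (size-ones (<⇒≤ j<N)) (fromℕ< j<N)
... | D , s , 1≤D = <⇒≱ 1≤D (≤-reflexive (trans (stuck s (fromℕ< j<N)) (ones-fromℕ< j<N)))
  where
  stuck : ∀ {D} → Star (Step Γ) (ones j) D → ∀ x → D x ≡ ones j x
  stuck ε                    x = refl
  stuck (step v w a 2≤ ◅ _) x = contradiction 2≤ (<⇒≱ (s≤s (ones≤1 j v)))

-- The hypothesis on δ

-- `hyp` is the inequality of the theorem raised to the power `δ`, which keeps the exponents
-- integral.
module _ (n δ : ℕ) .{{_ : NonZero δ}} (hyp : 2 ^ (12 * n + 15 * δ) ≤ δ ^ δ) where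

  open ≤-Reasoning

  private
    q t : ℕ
    q = n / δ
    t = 2 ^ q

  n<[1+n/δ]δ : n < suc (n / δ) * δ
  n<[1+n/δ]δ = begin-strict
    n                   ≡⟨ m≡m%n+[m/n]*n n δ ⟩
    n % δ + q * δ       <⟨ +-monoˡ-< (q * δ) (m%n<n n δ) ⟩
    suc q * δ           ∎

  private
    -- Take the `δ`-th root of `hyp`: since `q * δ ≤ n`, the reverse strict inequality would
    -- contradict it after raising to the power `δ`.
    2^[12q+15]≤δ : 2 ^ (12 * q + 15) ≤ δ
    2^[12q+15]≤δ = ≮⇒≥ (λ δ< → <⇒≱ (^-monoˡ-< δ δ<) (begin
      (2 ^ (12 * q + 15)) ^ δ    ≡⟨ ^-*-assoc 2 (12 * q + 15) δ ⟩
      2 ^ ((12 * q + 15) * δ)    ≡⟨ cong (2 ^_) (lemma q δ) ⟩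
      2 ^ (12 * (q * δ) + 15 * δ) ≤⟨ ^-monoʳ-≤ 2 (+-monoˡ-≤ (15 * δ) (*-monoʳ-≤ 12 (m/n*n≤m n δ))) ⟩
      2 ^ (12 * n + 15 * δ)      ≤⟨ hyp ⟩
      δ ^ δ                      ∎))
      where
      lemma : ∀ q δ → (12 * q + 15) * δ ≡ 12 * (q * δ) + 15 * δ
      lemma = solve-∀

    -- Since `q + 1 ≤ 2 ^ q`, the bound on `n` also becomes a power of two times `δ`.
    n≤tδ : n ≤ t * δ
    n≤tδ = ≤-trans (<⇒≤ n<[1+n/δ]δ) (*-monoˡ-≤ δ (n<2^n q))
      where
      n<2^n : ∀ k → k < 2 ^ k
      n<2^n zero    = s≤s z≤n
      n<2^n (suc k) = begin
        suc (suc k)     ≤⟨ +-mono-≤ (m^n>0 2 k) (n<2^n k) ⟩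
        2 ^ k + 2 ^ k   ≡⟨ cong (2 ^ k +_) (+-identityʳ (2 ^ k)) ⟨
        2 ^ suc k       ∎

  4n≤δ² : 4 * n ≤ δ * δ
  4n≤δ² = begin
    4 * n               ≤⟨ *-monoʳ-≤ 4 n≤tδ ⟩
    4 * (t * δ)         ≡⟨ *-assoc 4 t δ ⟨
    2 ^ 2 * t * δ       ≡⟨ cong (_* δ) (^-distribˡ-+-* 2 2 q) ⟨
    2 ^ (2 + q) * δ     ≤⟨ *-monoˡ-≤ δ (^-monoʳ-≤ 2 exponent) ⟩
    2 ^ (12 * q + 15) * δ ≤⟨ *-monoˡ-≤ δ 2^[12q+15]≤δ ⟩
    δ * δ               ∎
    where
    exponent : 2 + q ≤ 12 * q + 15
    exponent = subst (2 + q ≤_) (lemma q) (m≤m+n (2 + q) (11 * q + 13))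
      where
      lemma : ∀ q → 2 + q + (11 * q + 13) ≡ 12 * q + 15
      lemma = solve-∀

  -- Here `L` is `2 ^ (6q)` and `n * n` is at most `2 ^ (2q)` times `δ * δ`, so the left side is at
  -- most `2 ^ (8q + 3)` times `δ * δ`; the remaining factor `δ` is at least `2 ^ (12q + 15)`.
  8Ln²<δ³ : 8 * (2 ^ (n / δ * 3) * 2 ^ (n / δ * 3)) * (n * n) < δ * δ * δ
  8Ln²<δ³ = begin-strict
    8 * (2 ^ (q * 3) * 2 ^ (q * 3)) * (n * n)
      ≤⟨ *-monoʳ-≤ (8 * (2 ^ (q * 3) * 2 ^ (q * 3))) (*-mono-≤ n≤tδ n≤tδ) ⟩
    8 * (2 ^ (q * 3) * 2 ^ (q * 3)) * (t * δ * (t * δ))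
      ≡⟨ lemma₁ (2 ^ (q * 3)) t δ ⟩
    2 ^ 3 * (2 ^ (q * 3) * (2 ^ (q * 3) * (t * t))) * (δ * δ)
      ≡⟨ cong (_* (δ * δ)) collect ⟨
    2 ^ (3 + (q * 3 + (q * 3 + (q + q)))) * (δ * δ)
      <⟨ *-monoˡ-< (δ * δ) (^-monoʳ-< 2 ≤-refl exponent) ⟩
    2 ^ (12 * q + 15) * (δ * δ)
      ≤⟨ *-monoˡ-≤ (δ * δ) 2^[12q+15]≤δ ⟩
    δ * (δ * δ)
      ≡⟨ *-assoc δ δ δ ⟨
    δ * δ * δ ∎
    where
    instance
      δ²≢0 : NonZero (δ * δ)
      δ²≢0 = m*n≢0 δ δ

    lemma₁ : ∀ s t δ → 8 * (s * s) * (t * δ * (t * δ)) ≡ 8 * (s * (s * (t * t))) * (δ * δ)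
    lemma₁ = solve-∀

    collect : 2 ^ (3 + (q * 3 + (q * 3 + (q + q)))) ≡ 2 ^ 3 * (2 ^ (q * 3) * (2 ^ (q * 3) * (t * t)))
    collect = trans (^-distribˡ-+-* 2 3 (q * 3 + (q * 3 + (q + q)))) (cong (2 ^ 3 *_)
      (trans (^-distribˡ-+-* 2 (q * 3) (q * 3 + (q + q))) (cong (2 ^ (q * 3) *_)
        (trans (^-distribˡ-+-* 2 (q * 3) (q + q)) (cong (2 ^ (q * 3) *_) (^-distribˡ-+-* 2 q q))))))

    exponent : 3 + (q * 3 + (q * 3 + (q + q))) < 12 * q + 15
    exponent = subst (4 + (q * 3 + (q * 3 + (q + q))) ≤_) (lemma q) (m≤m+n _ (4 * q + 11))
      where
      lemma : ∀ q → 4 + (q * 3 + (q * 3 + (q + q))) + (4 * q + 11) ≡ 12 * q + 15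
      lemma = solve-∀

-- The pebbling number of the product

theorem7 : (n : ℕ) (G H : Graph n) → Connected G → Connected H →
    0 < minDegree G ⊓ minDegree H →
    2 ^ (12 * n + 15 * (minDegree G ⊓ minDegree H))
    ≤ (minDegree G ⊓ minDegree H) ^ (minDegree G ⊓ minDegree H) →
    Class0 (G □ H)
theorem7 n G H connG connH 0<δ hyp = solvable , pebbling-number≥order (G □ H)
  where
  δ = minDegree G ⊓ minDegree H

  instance
    δ≢0 : NonZero δ
    δ≢0 = >-nonZero 0<δ

  solvable : ∀ C → size C ≡ n * n → Solvable (G □ H) C
  solvable C size≡ r with combine-surjective {n} {n} r
  ... | g₀ , h₀ , refl = Grid.Gathering.grid-solvable G H C
    (λ v → ≤-trans (m⊓n≤m _ _) (minOver≤ (degree G) v))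
    (λ v → ≤-trans (m⊓n≤n (minDegree G) _) (minOver≤ (degree H) v))
    connG connH (n / δ) (n<[1+n/δ]δ n δ hyp) size≡ (4n≤δ² n δ hyp) (8Ln²<δ³ n δ hyp) g₀ h₀
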